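{- Let $A$ be a set and let $\Gamma$ be a finite set of unary relations on $A$ (i.e. a finite set of subsets of $A$) containing some $\gamma\in\Gamma$ with $\emptyset\neq\gamma\subsetneq A$. Then $$\bigl|\{\operatorname{Pol}_A Q \mid Q\subseteq \mathrm{DD}(\Gamma),\ Q \text{ finite}\}\bigr| = \bigl|\{\operatorname{Pol}_A Q \mid Q\subseteq \mathrm{DD}(\Gamma)\}\bigr| = \aleph_0 .$$
   Context: An $n$-ary relation on $A$ is a subset of $A^n$; an $n$-ary operation on $A$ is a map $A^n\to A$. Let $\mathrm{O}_A$ be the set of all operations on $A$ of arity $n\geq 1$. An $n$-ary operation $f$ preserves an $m$-ary relation $\rho\subseteq A^m$ (written $f\rhd\rho$) if for all $r_1,\dots,r_n\in\rho$ the $m$-tuple obtained by applying $f$ coordinatewise to $r_1,\dots,r_n$ is in $\rho$. For a set $Q$ of finitary relations on $A$ (of positive arity), $\operatorname{Pol}_A Q=\{f\in \mathrm{O}_A\mid f\rhd\rho \text{ for all }\rho\in Q\}$. For $n\geq 1$ and $\gamma_1,\dots,\gamma_n\subseteq A$ put $\mathrm{R}(\gamma_1,\dots,\gamma_n)=\{(x_1,\dots,x_n)\in A^n\mid x_1\in\gamma_1\text{ or }\dots\text{ or }x_n\in\gamma_n\}$. For a set $\Gamma$ of unary relations on $A$, $\mathrm{DD}(\Gamma)$ is the set of all relations $\mathrm{R}(\gamma_1,\dots,\gamma_n)$ with $n\geq 1$ and $(\gamma_1,\dots,\gamma_n)\in\Gamma^n$. -}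

module Defs where

open import Data.Fin.Base using (Fin)
open import Data.List.Base using (List)
import Data.List.Membership.Setoid as SetoidMembership
open import Data.Nat.Base using (ℕ; suc)
open import Data.Product.Base using (Σ; ∃; _×_; _,_; proj₁)
open import Data.Vec.Base using (Vec; lookup; map; transpose)
open import Data.Vec.Relation.Unary.All using (All)
open import Level using (Level) renaming (suc to lsuc)
open import Relation.Binary.Bundles using (Setoid)
import Relation.Binary.Construct.On as On
open import Relation.Binary.Core using (Rel)
open import Relation.Binary.Definitions using (_Respects_)
open import Relation.Binary.Structures using (IsEquivalence)
open import Relation.Unary using (Pred; _∈_; _⊆_; _≐_)
open import Relation.Unary.Properties using (≐-refl; ≐-sym; ≐-trans)
open import Relation.Unary.Relation.Binary.Equality using (≐-setoid)

private
  variable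
    a c ℓ p : Level
    A : Set a
    m n : ℕ

-- Sets are predicates, compared extensionally by _≐_.  With excluded middle
-- every predicate is equivalent to one at the lowest level, so fixing the
-- levels below does not restrict which sets occur.

-- The elements of P are, up to the setoid equality, exactly those of a list.
Finite : (S : Setoid c ℓ) → Pred (Setoid.Carrier S) p → Set _
Finite S P = ∃ λ xs → P ≐ (λ x → x ∈ₛ xs)
  where open SetoidMembership S using () renaming (_∈_ to _∈ₛ_)

-- Arities are positive: the component n stands for arity suc n.

Operation : Set a → Set a
Operation A = ∃ λ n → Vec A (suc n) → A

Relation : Set a → Set (lsuc a)
Relation {a} A = ∃ λ n → Pred (Vec A (suc n)) a

data _≈ᴿ_ {A : Set a} : Rel (Relation A) (lsuc a) where
  same : {ρ σ : Pred (Vec A (suc n)) a} → ρ ≐ σ → (n , ρ) ≈ᴿ (n , σ)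

≈ᴿ-isEquivalence : IsEquivalence (_≈ᴿ_ {A = A})
≈ᴿ-isEquivalence = record
  { refl  = same ≐-refl
  ; sym   = λ { (same e) → same (≐-sym e) }
  ; trans = λ { (same e) (same e′) → same (≐-trans e e′) }
  }

relationSetoid : Set a → Setoid (lsuc a) (lsuc a)
relationSetoid A = record { isEquivalence = ≈ᴿ-isEquivalence {A = A} }

Preserves : (Vec A n → A) → Pred (Vec A m) ℓ → Set _
Preserves {A = A} {n = n} {m = m} f ρ =
  (rs : Vec (Vec A m) n) → All ρ rs → map f (transpose rs) ∈ ρ

_▷_ : {A : Set a} → Operation A → Relation A → Set a
(_ , f) ▷ (_ , ρ) = Preserves f ρ

Pol : {A : Set a} → Pred (Relation A) (lsuc a) → Pred (Operation A) (lsuc a)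
Pol Q f = ∀ ρ → ρ ∈ Q → f ▷ ρ

R : {A : Set a} → Vec (Pred A a) n → Pred (Vec A n) a
R γs xs = ∃ λ i → lookup xs i ∈ lookup γs i

DD : {A : Set a} → Pred (Pred A a) (lsuc a) → Pred (Relation A) (lsuc a)
DD {A = A} Γ ρ =
  ∃ λ n → Σ (Vec (Pred A _) (suc n)) λ γs → All Γ γs × ρ ≈ᴿ (n , R γs)

Pols : {A : Set a} → Pred (Pred A a) (lsuc a) →
       Pred (Pred (Operation A) (lsuc a)) (lsuc (lsuc a))
Pols {a} {A} Γ C = Σ (Pred (Relation A) (lsuc a)) λ Q →
  Q Respects _≈ᴿ_ × Q ⊆ DD Γ × C ≐ Pol Q

FinPols : {A : Set a} → Pred (Pred A a) (lsuc a) →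
          Pred (Pred (Operation A) (lsuc a)) (lsuc (lsuc a))
FinPols {a} {A} Γ C = Σ (Pred (Relation A) (lsuc a)) λ Q →
  Q Respects _≈ᴿ_ × Q ⊆ DD Γ × Finite (relationSetoid A) Q × C ≐ Pol Q

-- A family of subsets of X as a setoid: proofs of membership are irrelevant.
familySetoid : {X : Set a} → Pred (Pred X ℓ) p → Setoid _ _
familySetoid {ℓ = ℓ} {X = X} 𝓕 = On.setoid {B = ∃ 𝓕} (≐-setoid X ℓ) proj₁

{-# OPTIONS --safe #-}

-- Identifying coordinates shows that R(γ₁,…,γₙ) matters for polymorphisms only
-- through the multiset of the γᵢ, a vector in ℕᵏ when Γ has k members, and that
-- preserving a multiset entails preserving every smaller one with the same
-- support.  So Pol Q is determined by a set of vectors closed downwards for an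
-- order that is a well-quasi-order by Dickson's lemma; the finitely many
-- minimal vectors outside that set are a code for Pol Q.  Conversely, for
-- x ∈ γ and y ∉ γ, the n-ary operation with value x on tuples having at least
-- two entries in γ, and y elsewhere, preserves the relations R(γ,…,γ) of arity
-- less than n, by the pigeonhole principle, but not the one of arity n.

module Submission where

open import Defs
open import Axiom.ExcludedMiddle using (ExcludedMiddle)
open import Data.Empty using (⊥-elim)
open import Data.Fin.Base using (Fin; zero; suc; inject≤; fromℕ<; toℕ)
import Data.Fin.Properties as Fin
open import Data.List.Base as List using (List; []; _∷_; _++_)
open import Data.List.Membership.Propositional using () renaming (_∈_ to _∈ₗ_)
open import Data.List.Membership.Propositional.Properties
  using (∈-allFin; ∈-filter⁺; ∈-filter⁻; ∈-lookup)
import Data.List.Properties as List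
open import Data.List.Relation.Unary.All as ListAll using ([]; _∷_)
import Data.List.Relation.Unary.All.Properties as ListAll
open import Data.List.Relation.Unary.AllPairs using ([]; _∷_)
open import Data.List.Relation.Unary.Any as Any using (Any; here; there; index)
import Data.List.Relation.Unary.Any.Properties as Any
open import Data.List.Relation.Unary.Unique.Propositional using (Unique)
open import Data.List.Relation.Unary.Unique.Propositional.Properties
  using (allFin⁺; filter⁺)
open import Data.Nat.Base
  using (ℕ; zero; suc; _+_; _∸_; _≤_; _<_; _≤′_; z≤n; s≤s; ≤′-refl; ≤′-step; _⊔_)
open import Data.Nat.Binary.Base as ℕᵇ using (ℕᵇ; 2[1+_]; 1+[2_])
import Data.Nat.Binary.Properties as ℕᵇ
open import Data.Nat.Properties
  using (≤-refl; ≤-trans; ≤-antisym; ≤-reflexive; <-irrefl; <-cmp;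
         n≤1+n; n<1+n; +-suc; +-identityʳ; m∸n+n≡m; ≰⇒>; ≤⇒≤′; ≤∧≢⇒<; _<?_; ≮⇒≥;
         m≤m⊔n; m≤n⊔m; ≤-pred; m<1+n⇒m<n∨m≡n)
open import Data.Product.Base using (Σ; ∃; ∃₂; _×_; _,_; proj₁; proj₂)
open import Data.Sum.Base using (inj₁; inj₂)
open import Data.Vec.Base as Vec
  using (Vec; []; _∷_; lookup; map; transpose; tabulate; replicate; toList; _[_]≔_)
import Data.Vec.Properties as Vec
open import Data.Vec.Relation.Binary.Pointwise.Inductive as Pointwise
  using (Pointwise; []; _∷_)
open import Data.Vec.Relation.Unary.All using (All)
import Data.Vec.Relation.Unary.All.Properties as All
open import Function.Base using (_∘_; const; id)
open import Function.Bundles using (Bijection; _⇔_; mk⇔; Equivalence)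
import Function.Construct.Composition as Composition
import Function.Construct.Symmetry as Symmetry
open import Function.Definitions using (Injective)
open import Level using (Level) renaming (suc to lsuc)
open import Relation.Binary.Bundles using (Setoid)
open import Relation.Binary.Definitions using (_Respects_; tri<; tri≈; tri>)
open import Relation.Binary.PropositionalEquality
  using (_≡_; _≢_; refl; sym; trans; cong; cong₂; subst; setoid; module ≡-Reasoning)
open import Relation.Binary.Structures using (IsEquivalence)
open import Relation.Nullary using (¬_; yes; no; contradiction)
open import Relation.Unary
  using (Pred; _∈_; _∉_; _⊆_; _⊂_; _≐_; _∪_; ∁; Satisfiable; U)
open import Relation.Unary.Properties using (≐-refl; ≐-sym; ≐-trans)
open import Relation.Unary.Relation.Binary.Equality using (≐-setoid)

private
  variable
    a p q s ℓ : Level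
    A : Set a
    I J : Set
    k m n : ℕ

-- Codes of finite lists of vectors

-- In this bijective base-two numeral, least significant digit first, an entry n becomes n digits 1
-- closed by a digit 2, so the entries can be read back.
toBinary : List ℕ → ℕᵇ
toBinary []           = ℕᵇ.zero
toBinary (zero  ∷ ns) = 2[1+ toBinary ns ]
toBinary (suc n ∷ ns) = 1+[2 toBinary (n ∷ ns) ]

toBinary-injective : Injective _≡_ _≡_ toBinary
toBinary-injective {[]} {[]} _ = refl
toBinary-injective {[]} {zero ∷ _} ()
toBinary-injective {[]} {suc _ ∷ _} ()
toBinary-injective {zero ∷ _} {[]} ()
toBinary-injective {suc _ ∷ _} {[]} ()
toBinary-injective {zero ∷ _} {suc _ ∷ _} ()
toBinary-injective {suc _ ∷ _} {zero ∷ _} ()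
toBinary-injective {zero ∷ _} {zero ∷ _} eq =
  cong (zero ∷_) (toBinary-injective (ℕᵇ.2[1+_]-injective eq))
toBinary-injective {suc m ∷ ms} {suc n ∷ ns} eq =
  let m≡n , ms≡ns = List.∷-injective
        (toBinary-injective {m ∷ ms} {n ∷ ns} (ℕᵇ.1+[2_]-injective eq))
  in cong₂ _∷_ (cong suc m≡n) ms≡ns

encodeList : List ℕ → ℕ
encodeList = ℕᵇ.toℕ ∘ toBinary

encodeList-injective : Injective _≡_ _≡_ encodeList
encodeList-injective = toBinary-injective ∘ ℕᵇ.toℕ-injective

encode : List (Vec ℕ k) → ℕ
encode = encodeList ∘ List.map (encodeList ∘ toList)

encode-injective : Injective _≡_ _≡_ (encode {k})
encode-injective =
  List.map-injective (toList-injective ∘ encodeList-injective) ∘ encodeList-injective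
  where
  toList-injective : Injective _≡_ _≡_ (toList {A = ℕ} {n = n})
  toList-injective {x = u} {y = v} eq =
    trans (sym (Vec.cast-is-id refl u)) (Vec.toList-injective refl u v eq)

-- Comparison of multisets

infix 4 _≼_ _⊑_

-- Zero is comparable only to itself, so that comparable multisets have the same
-- support.
data _≼_ : ℕ → ℕ → Set where
  zero : zero ≼ zero
  suc  : m ≤ n → suc m ≼ suc n

≼-refl : m ≼ m
≼-refl {zero}  = zero
≼-refl {suc _} = suc ≤-refl

_⊑_ : Vec ℕ k → Vec ℕ k → Set
_⊑_ = Pointwise _≼_

-- Truncation to min(i, m). It fixes the first `suc m` indices, hence is a retraction of `inject≤`
-- and surjective.
shrink : m ≤ n → Fin (suc n) → Fin (suc m)
shrink z≤n     _       = zero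
shrink (s≤s _) zero    = zero
shrink (s≤s p) (suc i) = suc (shrink p i)

shrink-inject≤ : (p : m ≤ n) (i : Fin (suc m)) → shrink p (inject≤ i (s≤s p)) ≡ i
shrink-inject≤ z≤n     zero    = refl
shrink-inject≤ (s≤s _) zero    = refl
shrink-inject≤ (s≤s p) (suc i) = cong suc (shrink-inject≤ p i)

≼-surjection : m ≼ n → ∃ λ (φ : Fin n → Fin m) → ∀ i → ∃ λ j → φ j ≡ i
≼-surjection zero    = id , λ i → i , refl
≼-surjection (suc p) = shrink p , λ i → inject≤ i (s≤s p) , shrink-inject≤ p i

-- Finite bases

-- Generators are required to lie in `P` rather than in `V`: a basis of `P` is assembled from pieces
-- `V` whose generators may come from elsewhere in `P`.
FiniteBasis : Pred (Vec ℕ k) p → Pred (Vec ℕ k) q → Set _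
FiniteBasis P V = ∃ λ gs → ListAll.All P gs × (∀ {v} → v ∈ V → Any (_⊑ v) gs)

basis-∪ : {P : Pred (Vec ℕ k) p} {V : Pred (Vec ℕ k) q} {W : Pred (Vec ℕ k) s} →
          FiniteBasis P V → FiniteBasis P W → FiniteBasis P (V ∪ W)
basis-∪ (gs , Pgs , g) (hs , Phs , h) = gs ++ hs , ListAll.++⁺ Pgs Phs , λ where
  (inj₁ v∈V) → Any.++⁺ˡ (g v∈V)
  (inj₂ v∈W) → Any.++⁺ʳ gs (h v∈W)

basis-⊆ : {P : Pred (Vec ℕ k) p} {V : Pred (Vec ℕ k) q} {W : Pred (Vec ℕ k) s} →
          W ⊆ V → FiniteBasis P V → FiniteBasis P W
basis-⊆ W⊆V (gs , Pgs , g) = gs , Pgs , g ∘ W⊆V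

-- `N` is the largest of the finitely many witnesses, so from `N` on the head no longer matters.
-- Heads are successors because `_≼_` never compares zero with a positive number.
lift-basis : {P : Pred (Vec ℕ (suc k)) p} (gs : List (Vec ℕ k)) →
  ListAll.All (λ u → ∃ λ n → P (suc n ∷ u)) gs →
  ∃₂ λ N hs → ListAll.All P hs ×
    (∀ {n v} → N ≤ n → Any (_⊑ v) gs → Any (_⊑ suc n ∷ v) hs)
lift-basis []       []              = 0 , [] , [] , λ _ ()
lift-basis (g ∷ gs) ((n , Pg) ∷ Pgs) =
  let N , hs , Phs , h = lift-basis gs Pgs
  in n ⊔ N , (suc n ∷ g) ∷ hs , Pg ∷ Phs , λ where
    le (here g⊑v) → here (suc (≤-trans (m≤m⊔n n N) le) ∷ g⊑v)
    le (there i)  → there (h (≤-trans (m≤n⊔m n N) le) i)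

basis-slice : {P : Pred (Vec ℕ (suc k)) p} (n : ℕ) →
  FiniteBasis (λ v → P (n ∷ v)) (λ v → P (n ∷ v)) →
  FiniteBasis P (λ v → P v × Vec.head v ≡ n)
basis-slice n (gs , Pgs , g) = List.map (n ∷_) gs , ListAll.map⁺ Pgs ,
  λ { {_ ∷ _} (Pv , refl) → Any.map⁺ (Any.map (≼-refl ∷_) (g Pv)) }

-- Families of predicates as labelled relations

-- `X` gives the rows of a matrix, and the hypothesis puts each of its columns in the relation. An
-- arbitrary index type lets coordinates be regrouped without arithmetic on arities.
PreservesFamily : {I : Set} {A : Set a} → (Vec A m → A) → (I → Pred A a) → Set a
PreservesFamily {m = m} {I = I} {A = A} f γ =
  (X : I → Vec A m) → (∀ j → ∃ λ i → lookup (X i) j ∈ γ i) → ∃ λ i → f (X i) ∈ γ i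

-- The relation R(δ) arises from R(γ) by identifying the coordinates in each fibre of `to`.
record Covers {A : Set a} (γ : I → Pred A a) (δ : J → Pred A a) : Set a where
  field
    to         : I → J
    surjective : ∀ j → ∃ λ i → to i ≡ j
    labels     : ∀ i → γ i ≐ δ (to i)

covers-≐ : {γ δ : I → Pred A a} → (∀ i → γ i ≐ δ i) → Covers γ δ
covers-≐ γ≐δ = record { to = id ; surjective = λ i → i , refl ; labels = γ≐δ }

-- Rows for `δ` are repeated along `to`. Surjectivity keeps every column in the relation, and the
-- coordinate where the result lands is carried forward by `to`.
preserves-covers : {γ : I → Pred A a} {δ : J → Pred A a} (f : Vec A m → A) →
                   Covers γ δ → PreservesFamily f γ → PreservesFamily f δ
preserves-covers {γ = γ} {δ = δ} f cov pres X hits =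
  let i , fXi = pres (X ∘ to) hits′ in to i , proj₁ (labels i) fXi
  where
  open Covers cov
  hits′ : ∀ j → ∃ λ i → lookup (X (to i)) j ∈ γ i
  hits′ j with hits j
  ... | i′ , x∈δ with surjective i′
  ... | i , refl = i , proj₂ (labels i) x∈δ

lookup-transpose : (xss : Vec (Vec A n) m) (i : Fin n) →
                   lookup (transpose xss) i ≡ map (λ xs → lookup xs i) xss
lookup-transpose []         i = Vec.lookup-replicate i []
lookup-transpose {A = A} {n = n} {m = suc m} (xs ∷ xss) i = begin
  lookup ((replicate n cons Vec.⊛ xs) Vec.⊛ transpose xss) i
    ≡⟨ Vec.lookup-⊛ i (replicate n cons Vec.⊛ xs) (transpose xss) ⟩
  lookup (replicate n cons Vec.⊛ xs) i column
    ≡⟨ cong (λ g → g column) (Vec.lookup-⊛ i (replicate n cons) xs) ⟩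
  lookup (replicate n cons) i (lookup xs i) column
    ≡⟨ cong (λ g → g (lookup xs i) column) (Vec.lookup-replicate i cons) ⟩
  lookup xs i ∷ column
    ≡⟨ cong (lookup xs i ∷_) (lookup-transpose xss i) ⟩
  lookup xs i ∷ map (λ xs → lookup xs i) xss ∎
  where
  open ≡-Reasoning
  cons : A → Vec A m → Vec A (suc m)
  cons = _∷_
  column : Vec A m
  column = lookup (transpose xss) i

-- Tuples of `ρ` are columns while a family supplies rows, so both directions are transposition.
preserves⇔ : {A : Set a} (γs : Vec (Pred A a) n) {ρ : Pred (Vec A n) a} (f : Vec A m → A) →
             ρ ≐ R γs → Preserves f ρ ⇔ PreservesFamily f (lookup γs)
preserves⇔ {n = n} {m = m} {A = A} γs {ρ} f (ρ⊆R , R⊆ρ) = mk⇔ to from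
  where
  to : Preserves f ρ → PreservesFamily f (lookup γs)
  to pres X hits =
    let i , fi = ρ⊆R (pres columns (All.tabulate⁺ λ j → R⊆ρ (column∈R j)))
    in i , subst (lookup γs i) (value i) fi
    where
    columns : Vec (Vec A n) m
    columns = tabulate λ j → tabulate λ i → lookup (X i) j

    column∈R : ∀ j → R γs (tabulate λ i → lookup (X i) j)
    column∈R j = let i , x∈γ = hits j in
      i , subst (lookup γs i) (sym (Vec.lookup∘tabulate _ i)) x∈γ

    row : ∀ i → lookup (transpose columns) i ≡ X i
    row i = begin
      lookup (transpose columns) i                 ≡⟨ lookup-transpose columns i ⟩
      map (λ xs → lookup xs i) columns             ≡⟨ Vec.tabulate-∘ _ _ ⟨
      tabulate (λ j → lookup (tabulate λ i → lookup (X i) j) i)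
        ≡⟨ Vec.tabulate-cong (λ j → Vec.lookup∘tabulate (λ i → lookup (X i) j) i) ⟩
      tabulate (lookup (X i))                      ≡⟨ Vec.tabulate∘lookup (X i) ⟩
      X i                                          ∎
      where open ≡-Reasoning

    value : ∀ i → lookup (map f (transpose columns)) i ≡ f (X i)
    value i = trans (Vec.lookup-map i f (transpose columns)) (cong f (row i))

  from : PreservesFamily f (lookup γs) → Preserves f ρ
  from pres rs rs∈ρ =
    let i , fi = pres (lookup (transpose rs)) hits
    in R⊆ρ (i , subst (lookup γs i) (sym (Vec.lookup-map i f (transpose rs))) fi)
    where
    hits : ∀ j → ∃ λ i → lookup (lookup (transpose rs) i) j ∈ lookup γs i
    hits j =
      let i , x∈γ = ρ⊆R (All.lookup⁺ rs∈ρ j)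
      in i , subst (lookup γs i)
               (sym (trans (cong (λ r → lookup r j) (lookup-transpose rs i))
                           (Vec.lookup-map j _ rs)))
               x∈γ

-- Multisets of labels

multiset : {A : Set a} → (Fin k → Pred A a) → (v : Fin k → ℕ) →
           Σ (Fin k) (Fin ∘ v) → Pred A a
multiset δ v (c , _) = δ c

-- Copies of one label may be merged as long as one survives; this is the equality of supports built
-- into `_≼_`.
multiset-covers : (δ : Fin k → Pred A a) {u v : Fin k → ℕ} → (∀ c → u c ≼ v c) →
                  Covers (multiset δ v) (multiset δ u)
multiset-covers δ u≼v = record
  { to         = λ (c , i) → c , proj₁ (≼-surjection (u≼v c)) i
  ; surjective = λ (c , j) → let i , eq = proj₂ (≼-surjection (u≼v c)) j
                             in (c , i) , cong (c ,_) eq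
  ; labels     = λ _ → ≐-refl
  }

lookup-injective : {xs : List A} → Unique xs → ∀ i j →
                   List.lookup xs i ≡ List.lookup xs j → i ≡ j
lookup-injective (_ ∷ _)  zero    zero    _  = refl
lookup-injective (x∉ ∷ _) zero    (suc j) eq =
  contradiction eq (ListAll.lookup x∉ (∈-lookup j))
lookup-injective (x∉ ∷ _) (suc i) zero    eq =
  contradiction (sym eq) (ListAll.lookup x∉ (∈-lookup i))
lookup-injective (_ ∷ u)  (suc i) (suc j) eq = cong suc (lookup-injective u i j eq)

-- The multiplicity of a label is the size of its fibre under `w`. The two coverings below are
-- mutually inverse bijections of coordinates, so passing to the multiset loses nothing.
module Fibres {A : Set a} {γ : Fin n → Pred A a} {δ : Fin k → Pred A a}
              (w : Fin n → Fin k) (γ≐δ : ∀ i → γ i ≐ δ (w i)) where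

  fibre : Fin k → List (Fin n)
  fibre c = List.filter (λ i → w i Fin.≟ c) (List.allFin n)

  size : Fin k → ℕ
  size = List.length ∘ fibre

  w-lookup : ∀ c t → w (List.lookup (fibre c) t) ≡ c
  w-lookup c t = proj₂ (∈-filter⁻ (λ i → w i Fin.≟ c) {xs = List.allFin n} (∈-lookup t))

  ∈-fibre : ∀ i → i ∈ₗ fibre (w i)
  ∈-fibre i = ∈-filter⁺ (λ j → w j Fin.≟ w i) (∈-allFin i) refl

  position : Fin n → Σ (Fin k) (Fin ∘ size)
  position i = w i , index (∈-fibre i)

  position-lookup : ∀ {c} i t → w i ≡ c → List.lookup (fibre c) t ≡ i → position i ≡ (c , t)
  -- A fibre lists no coordinate twice, so the position found by search is the given `t`.
  position-lookup i t refl eq = cong (w i ,_)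
    (lookup-injective (filter⁺ (λ j → w j Fin.≟ w i) (allFin⁺ n)) _ _
      (trans (sym (Any.lookup-index (∈-fibre i))) (sym eq)))

  covers-multiset : Covers γ (multiset δ size)
  covers-multiset = record
    { to         = position
    ; surjective = λ (c , t) → List.lookup (fibre c) t , position-lookup _ t (w-lookup c t) refl
    ; labels     = γ≐δ
    }

  multiset-covered : Covers (multiset δ size) γ
  multiset-covered = record
    { to         = λ (c , t) → List.lookup (fibre c) t
    ; surjective = λ i → position i , sym (Any.lookup-index (∈-fibre i))
    ; labels     = λ (c , t) → ≐-sym
        (subst (λ d → γ (List.lookup (fibre c) t) ≐ δ d) (w-lookup c t) (γ≐δ _))
    }

PreservesVec : {A : Set a} → (Fin k → Pred A a) → Operation A → Vec ℕ k → Set a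
PreservesVec δ (_ , f) v = PreservesFamily f (multiset δ (lookup v))

preservesVec-⊑ : {A : Set a} (δ : Fin k → Pred A a) {u v : Vec ℕ k} (f : Operation A) →
                 u ⊑ v → PreservesVec δ f v → PreservesVec δ f u
preservesVec-⊑ δ (_ , f) u⊑v = preserves-covers f (multiset-covers δ (Pointwise.lookup u⊑v))

-- Each coordinate takes the index at which its label was found in `δs`. The list may repeat a
-- predicate, since only this choice of indices matters.
DD-multiplicities : {A : Set a} {Γ : Pred (Pred A a) (lsuc a)}
  ((δs , _) : Finite (≐-setoid A a) Γ) →
  ∀ {ρ} → ρ ∈ DD Γ → ∃ λ v → ∀ f → f ▷ ρ ⇔ PreservesVec (List.lookup δs) f v
DD-multiplicities {a = a} {A = A} (δs , Γ⊆δs , _) (n , γs , γs∈Γ , same ρ≐R) =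
  tabulate size , λ (_ , f) → mk⇔
    (preserves-covers f (multiset-covers δ (λ c → subst (_≼ size c) (sym (lookup-size c)) ≼-refl))
      ∘ preserves-covers f covers-multiset ∘ Equivalence.to (preserves⇔ γs f ρ≐R))
    (Equivalence.from (preserves⇔ γs f ρ≐R) ∘ preserves-covers f multiset-covered
      ∘ preserves-covers f
          (multiset-covers δ (λ c → subst (size c ≼_) (sym (lookup-size c)) ≼-refl)))
  where
  δ : Fin (List.length δs) → Pred A a
  δ = List.lookup δs

  γ∈δs : ∀ i → Any (lookup γs i ≐_) δs
  γ∈δs i = Γ⊆δs (All.lookup⁺ γs∈Γ i)

  open Fibres {γ = lookup γs} {δ = δ} (index ∘ γ∈δs) (Any.lookup-index ∘ γ∈δs)

  lookup-size : ∀ c → lookup (tabulate size) c ≡ size c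
  lookup-size = Vec.lookup∘tabulate size

FinPols⊆Pols : {A : Set a} {Γ : Pred (Pred A a) (lsuc a)} → FinPols Γ ⊆ Pols Γ
FinPols⊆Pols (Q , resp , Q⊆DD , _ , C≐Pol) = Q , resp , Q⊆DD , C≐Pol

injective⇒unbounded : {h : ℕ → ℕ} → Injective _≡_ _≡_ h → ∀ N → ¬ (∀ i → h i < N)
injective⇒unbounded h-inj N h<N =
  let i , j , i<j , eq = Fin.pigeonhole (n<1+n N) (λ i → fromℕ< (h<N (toℕ i)))
  in <-irrefl (h-inj (Fin.fromℕ<-injective _ _ (h<N _) (h<N _) eq)) i<j

module _ (em : ∀ {ℓ} → ExcludedMiddle ℓ) where

  dne : {P : Set ℓ} → ¬ ¬ P → P
  dne {P = P} ¬¬p with em {P = P}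
  ... | yes p = p
  ... | no ¬p = contradiction ¬p ¬¬p

  -- Denumerable setoids

  least : {P : Pred ℕ p} → ∃ P → ∃ λ n → P n × (∀ {m} → P m → n ≤ m)
  least {P = P} (n , Pn) = search n 0 (subst P (sym (+-identityʳ n)) Pn) (λ _ → z≤n)
    where
    search : ∀ d k → P (d + k) → (∀ {m} → P m → k ≤ m) →
             ∃ λ n → P n × (∀ {m} → P m → n ≤ m)
    search d k Pd+k lb with em {P = P k}
    search d       k Pd+k lb | yes Pk = k , Pk , lb
    search zero    k Pk   lb | no ¬Pk = contradiction Pk ¬Pk
    search (suc d) k Pd+k lb | no ¬Pk =
      search d (suc k) (subst P (sym (+-suc d k)) Pd+k)
        λ Pm → ≤∧≢⇒< (lb Pm) λ { refl → ¬Pk Pm }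

  -- `rank n` counts the members of `P` below `n`; restricted to an unbounded `P` it is a bijection
  -- onto ℕ.
  module Rank (P : Pred ℕ p) where

    rank : ℕ → ℕ
    rank zero = zero
    rank (suc n) with em {P = P n}
    ... | yes _ = suc (rank n)
    ... | no  _ = rank n

    rank-∈ : P n → rank (suc n) ≡ suc (rank n)
    rank-∈ {n} Pn with em {P = P n}
    ... | yes _  = refl
    ... | no ¬Pn = contradiction Pn ¬Pn

    rank-∉ : ¬ P n → rank (suc n) ≡ rank n
    rank-∉ {n} ¬Pn with em {P = P n}
    ... | yes Pn = contradiction Pn ¬Pn
    ... | no  _  = refl

    rank-mono : m ≤′ n → rank m ≤ rank n
    rank-mono ≤′-refl = ≤-refl
    rank-mono (≤′-step {n} m≤n) with em {P = P n}
    ... | yes _ = ≤-trans (rank-mono m≤n) (n≤1+n _)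
    ... | no  _ = rank-mono m≤n

    rank-< : P m → m < n → rank m < rank n
    rank-< Pm m<n = ≤-trans (≤-reflexive (sym (rank-∈ Pm))) (rank-mono (≤⇒≤′ m<n))

    rank-injective : P m → P n → rank m ≡ rank n → m ≡ n
    rank-injective {m} {n} Pm Pn eq with <-cmp m n
    ... | tri< m<n _ _ = contradiction (rank-< Pm m<n) (<-irrefl eq)
    ... | tri≈ _ m≡n _ = m≡n
    ... | tri> _ _ n<m = contradiction (rank-< Pn n<m) (<-irrefl (sym eq))

    -- Rank stays constant until a member has been passed, and `d` bounds the search for the next
    -- one.
    rank-next : ∀ d n → P (d + n) → ∃ λ m → P m × rank m ≡ rank n
    rank-next d n Pd+n with em {P = P n}
    rank-next d       n Pd+n | yes Pn = n , Pn , refl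
    rank-next zero    n Pn   | no ¬Pn = contradiction Pn ¬Pn
    rank-next (suc d) n Pd+n | no ¬Pn =
      let m , Pm , eq = rank-next d (suc n) (subst P (sym (+-suc d n)) Pd+n)
      in m , Pm , trans eq (rank-∉ ¬Pn)

    rank-surjective : (∀ N → ∃ λ d → P (d + N)) → ∀ r → ∃ λ n → P n × rank n ≡ r
    rank-surjective unbounded zero =
      let d , Pd = unbounded 0 in rank-next d 0 Pd
    rank-surjective unbounded (suc r) =
      let n , Pn , eq    = rank-surjective unbounded r
          d , Pd         = unbounded (suc n)
          m , Pm , rank≡ = rank-next d (suc n) Pd
      in m , Pm , trans rank≡ (trans (rank-∈ Pn) (cong suc eq))

  -- An element may have many codes, so `Code` is a relation. The least code is invariant by `resp`
  -- and determines its element by `unique`. By `e` the least codes are unbounded, and `rank` closes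
  -- the gaps between them.
  denumerable : (S : Setoid s ℓ) (Code : ℕ → Pred (Setoid.Carrier S) p) →
    (∀ x → ∃ λ n → Code n x) →
    (∀ {n x y} → Code n x → Code n y → Setoid._≈_ S x y) →
    (∀ {n} → Code n Respects Setoid._≈_ S) →
    (e : ℕ → Setoid.Carrier S) → Injective _≡_ (Setoid._≈_ S) e → Bijection S (setoid ℕ)
  denumerable S Code total unique resp e e-inj = record
    { to        = rank ∘ code
    ; cong      = cong rank ∘ code-cong
    ; bijective =
        (λ {x} {y} eq → code-injective (rank-injective (x , refl) (y , refl) eq)) ,
        λ r → let n , (x , code≡) , rank≡ = rank-surjective unbounded r
              in x , λ z≈x → trans (cong rank (trans (code-cong z≈x) code≡)) rank≡
    }
    where
    open Setoid S using (Carrier; _≈_) renaming (sym to ≈-sym)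

    code : Carrier → ℕ
    code x = proj₁ (least (total x))

    Code-code : ∀ x → Code (code x) x
    Code-code x = proj₁ (proj₂ (least (total x)))

    code-least : ∀ {x n} → Code n x → code x ≤ n
    code-least {x} = proj₂ (proj₂ (least (total x)))

    code-cong : ∀ {x y} → x ≈ y → code x ≡ code y
    code-cong {x} {y} x≈y = ≤-antisym
      (code-least (resp (≈-sym x≈y) (Code-code y))) (code-least (resp x≈y (Code-code x)))

    code-injective : ∀ {x y} → code x ≡ code y → x ≈ y
    code-injective {x} {y} eq =
      unique (Code-code x) (subst (λ n → Code n y) (sym eq) (Code-code y))

    Image : Pred ℕ _
    Image n = ∃ λ x → code x ≡ n

    open Rank Image

    unbounded : ∀ N → ∃ λ d → Image (d + N)
    -- Were all least codes below `N`, composing `code` with `e` would inject ℕ into a finite set.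
    unbounded N = dne λ bounded →
      injective⇒unbounded (e-inj ∘ code-injective) N λ i → ≰⇒> λ N≤ →
        bounded (code (e i) ∸ N , e i , sym (m∸n+n≡m N≤))

  -- Dickson's lemma

  -- Induction on `k`. A basis of the tails that occur with a positive head settles all large heads
  -- at once; each of the finitely many remaining heads, zero included, leaves a set of shorter
  -- vectors.
  finite-basis : (P : Pred (Vec ℕ k) p) → FiniteBasis P P
  finite-basis {zero} P with em {P = P []}
  ... | yes P[] = [] ∷ [] , P[] ∷ [] , λ { {[]} _ → here [] }
  ... | no ¬P[] = [] , [] , λ { {[]} P[] → contradiction P[] ¬P[] }
  finite-basis {suc k} P =
    let gs , Pgs , g       = finite-basis λ u → ∃ λ n → P (suc n ∷ u)
        N , hs , Phs , h   = lift-basis gs Pgs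
    -- Heads at most `N` go slice by slice; a larger head is `suc n` with `N ≤ n`, where the lifted
    -- basis applies.
    in basis-⊆ (split N) (basis-∪ (below (suc N)) (hs , Phs ,
         λ { {_ ∷ _} (n , refl , N≤n , Pv) → h N≤n (g (n , Pv)) }))
    where
    Below Above : ℕ → Pred (Vec ℕ (suc k)) _
    Below N v = P v × Vec.head v < N
    Above N v = ∃ λ n → Vec.head v ≡ suc n × N ≤ n × P v

    below : ∀ N → FiniteBasis P (Below N)
    below zero    = [] , [] , λ ()
    below (suc N) = basis-⊆ step (basis-∪ (below N) (basis-slice N (finite-basis (P ∘ (N ∷_)))))
      where
      step : Below (suc N) ⊆ Below N ∪ (λ v → P v × Vec.head v ≡ N)
      step (Pv , lt) with m<1+n⇒m<n∨m≡n lt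
      ... | inj₁ lt′ = inj₁ (Pv , lt′)
      ... | inj₂ eq  = inj₂ (Pv , eq)

    split : ∀ N → P ⊆ Below (suc N) ∪ Above N
    split N {n ∷ v} Pv with n <? suc N
    split N {n ∷ v}     Pv | yes lt = inj₁ (Pv , lt)
    split N {zero ∷ v}  Pv | no ≮   = contradiction (s≤s z≤n) ≮
    split N {suc n ∷ v} Pv | no ≮   = inj₂ (n , refl , ≤-pred (≮⇒≥ ≮) , Pv)

  -- Codes for the sets Pol Q

  module _ {A : Set a} (Γ : Pred (Pred A a) (lsuc a)) (fin : Finite (≐-setoid A a) Γ) where

    δs : List (Pred A a)
    δs = proj₁ fin

    δ : Fin (List.length δs) → Pred A a
    δ = List.lookup δs

    PolAvoiding : List (Vec ℕ (List.length δs)) → Pred (Operation A) a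
    PolAvoiding gs f = ∀ v → ¬ Any (_⊑ v) gs → PreservesVec δ f v

    -- By `preservesVec-⊑`, adding to the vectors of `Q` all smaller ones leaves the polymorphisms
    -- unchanged. The resulting set is closed downwards, so a finite basis of its complement
    -- determines it.
    Pols-avoiding : ∀ {C} → C ∈ Pols Γ → ∃ λ gs → C ≐ PolAvoiding gs
    Pols-avoiding (Q , _ , Q⊆DD , C≐Pol) = gs , ≐-trans C≐Pol (to , from)
      where
      Represented Dominated : Pred (Vec ℕ (List.length δs)) (lsuc a)
      Represented v = ∃ λ ρ → ρ ∈ Q × (∀ f → f ▷ ρ ⇔ PreservesVec δ f v)
      Dominated u = ∃ λ v → u ⊑ v × Represented v

      basis = finite-basis (∁ Dominated)
      gs    = proj₁ basis

      to : Pol Q ⊆ PolAvoiding gs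
      -- A vector above no generator cannot lie in the complement, hence classically it lies below
      -- some vector of `Q`.
      to {f} f∈Pol v v∉↑gs with dne {P = Dominated v} (v∉↑gs ∘ proj₂ (proj₂ basis))
      ... | w , v⊑w , ρ , ρ∈Q , equiv =
        preservesVec-⊑ δ f v⊑w (Equivalence.to (equiv f) (f∈Pol ρ ρ∈Q))

      from : PolAvoiding gs ⊆ Pol Q
      -- A generator below a vector of `Q` would be dominated, although generators are chosen
      -- undominated.
      from {f} f∈ ρ ρ∈Q with DD-multiplicities fin (Q⊆DD ρ∈Q)
      ... | v , equiv = Equivalence.from (equiv f) (f∈ v λ g⊑v →
        let g∉Dominated , g⊑v = ListAll.lookupAny (proj₁ (proj₂ basis)) g⊑v
        in g∉Dominated (v , g⊑v , ρ , ρ∈Q , equiv))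

    -- Infinitely many different sets Pol Q

    module _ {γ : Pred A a} (γ∈Γ : γ ∈ Γ) {x y : A} (x∈γ : x ∈ γ) (y∉γ : y ∉ γ) where

      power : ℕ → Relation A
      power n = n , R (replicate (suc n) γ)

      module R≈ = IsEquivalence (≈ᴿ-isEquivalence {A = A})

      -- This is a singleton up to `_≈ᴿ_`, because the sets `Q` have to respect that equality.
      IsPower : ℕ → Pred (Relation A) (lsuc a)
      IsPower n ρ = power n ≈ᴿ ρ

      IsPower-respects : ∀ n → IsPower n Respects _≈ᴿ_
      IsPower-respects n σ≈τ ρ≈σ = R≈.trans ρ≈σ σ≈τ

      IsPower⊆DD : ∀ n → IsPower n ⊆ DD Γ
      IsPower⊆DD n e = n , replicate (suc n) γ ,
        All.lookup⁻ (λ i → subst Γ (sym (Vec.lookup-replicate i γ)) γ∈Γ) , R≈.sym e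

      IsPower-finite : ∀ n → Finite (relationSetoid A) (IsPower n)
      IsPower-finite n = power n ∷ [] , (λ e → here (R≈.sym e)) , λ { (here e) → R≈.sym e }

      chain : ℕ → ∃ (FinPols Γ)
      chain n = Pol (IsPower n) ,
        IsPower n , IsPower-respects n , IsPower⊆DD n , IsPower-finite n , id , id

      preserves-power⇔ : (f : Vec A m → A) →
        Preserves f (R (replicate n γ)) ⇔ PreservesFamily f (const {B = Fin n} γ)
      preserves-power⇔ {n = n} f = mk⇔
        (preserves-covers f (covers-≐ (≐-reflexive ∘ lookup-γ))
          ∘ Equivalence.to (preserves⇔ (replicate n γ) f ≐-refl))
        (Equivalence.from (preserves⇔ (replicate n γ) f ≐-refl)
          ∘ preserves-covers f (covers-≐ (≐-sym ∘ ≐-reflexive ∘ lookup-γ)))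
        where
        lookup-γ : (i : Fin n) → lookup (replicate n γ) i ≡ γ
        lookup-γ i = Vec.lookup-replicate i γ
        ≐-reflexive : {P Q : Pred A a} → P ≡ Q → P ≐ Q
        ≐-reflexive refl = ≐-refl

      TwoIn : Pred (Vec A m) a
      TwoIn xs = ∃₂ λ i j → i ≢ j × lookup xs i ∈ γ × lookup xs j ∈ γ

      threshold : Vec A m → A
      threshold xs with em {P = TwoIn xs}
      ... | yes _ = x
      ... | no  _ = y

      threshold-∈ : {xs : Vec A m} → TwoIn xs → threshold xs ∈ γ
      threshold-∈ {xs = xs} two with em {P = TwoIn xs}
      ... | yes _   = x∈γ
      ... | no ¬two = contradiction two ¬two

      threshold-∉ : {xs : Vec A m} → ¬ TwoIn xs → threshold xs ∉ γ
      threshold-∉ {xs = xs} ¬two with em {P = TwoIn xs}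
      ... | yes two = contradiction two ¬two
      ... | no  _   = y∉γ

      -- With fewer rows than columns, two columns are hit in the same row, which therefore has two
      -- entries in `γ`.
      threshold-preserves : m < n → PreservesFamily (threshold {m = n}) (const {B = Fin m} γ)
      threshold-preserves m<n X hits =
        let i , j , i<j , eq = Fin.pigeonhole m<n (proj₁ ∘ hits)
        in proj₁ (hits i) , threshold-∈ (i , j , Fin.<⇒≢ i<j , proj₂ (hits i) ,
             subst (λ r → lookup (X r) j ∈ γ) (sym eq) (proj₂ (hits j)))

      -- In the square matrix with `x` on the diagonal and `y` elsewhere, the diagonal hits every
      -- column, while each row has a single entry in `γ`.
      threshold-violates : ¬ PreservesFamily (threshold {m = n}) (const {B = Fin n} γ)
      threshold-violates {n = n} pres =
        let i , fi = pres unit (λ j → j , subst γ (sym (Vec.lookup∘updateAt j (replicate n y))) x∈γ)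
        in threshold-∉ (unit-¬two i) fi
        where
        unit : Fin n → Vec A n
        unit i = replicate n y [ i ]≔ x

        unit-∈ : ∀ i j → lookup (unit i) j ∈ γ → j ≡ i
        unit-∈ i j z∈γ with j Fin.≟ i
        ... | yes j≡i = j≡i
        ... | no  j≢i = contradiction
          (subst γ (trans (Vec.lookup∘updateAt′ j i j≢i (replicate n y))
                           (Vec.lookup-replicate j y)) z∈γ)
          y∉γ

        unit-¬two : ∀ i → ¬ TwoIn (unit i)
        unit-¬two i (j , k , j≢k , j∈ , k∈) =
          j≢k (trans (unit-∈ i j j∈) (sym (unit-∈ i k k∈)))

      chain-strict : m < n → ¬ proj₁ (chain m) ⊆ proj₁ (chain n)
      -- Index `n` stands for arity `suc n`: this `threshold` has as many arguments as `power n` has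
      -- coordinates, and more than `power m` has.
      chain-strict {m} {n} m<n sub = threshold-violates
        (Equivalence.to (preserves-power⇔ threshold)
          (sub {n , threshold} threshold∈ (power n) (same ≐-refl)))
        where
        γs = replicate (suc m) γ
        threshold∈ : proj₁ (chain m) (n , threshold)
        threshold∈ _ (same e) = Equivalence.from (preserves⇔ γs threshold (≐-sym e))
          (Equivalence.to (preserves⇔ γs threshold ≐-refl)
            (Equivalence.from (preserves-power⇔ threshold) (threshold-preserves (s≤s m<n))))

      chain-injective : proj₁ (chain m) ≐ proj₁ (chain n) → m ≡ n
      chain-injective {m} {n} (m⊆n , n⊆m) with <-cmp m n
      ... | tri< m<n _ _ = ⊥-elim (chain-strict m<n m⊆n)
      ... | tri≈ _ m≡n _ = m≡n
      ... | tri> _ _ n<m = ⊥-elim (chain-strict n<m n⊆m)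

      -- One statement serves both families: the upper bound supplies the codes, the lower bound the
      -- infinitely many members.
      between-denumerable : {𝓕 : Pred (Pred (Operation A) (lsuc a)) p} →
        FinPols Γ ⊆ 𝓕 → 𝓕 ⊆ Pols Γ → Bijection (familySetoid 𝓕) (setoid ℕ)
      between-denumerable FinPols⊆𝓕 𝓕⊆Pols = denumerable (familySetoid _)
        (λ n (C , _) → ∃ λ gs → encode gs ≡ n × C ≐ PolAvoiding gs)
        (λ (C , C∈𝓕) → let gs , C≐ = Pols-avoiding (𝓕⊆Pols C∈𝓕) in encode gs , gs , refl , C≐)
        (λ (gs , gs≡ , C≐) (hs , hs≡ , D≐) → ≐-trans C≐ (≐-sym
          (subst (λ ks → _ ≐ PolAvoiding ks) (encode-injective (trans hs≡ (sym gs≡))) D≐)))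
        (λ C≐D (gs , gs≡ , C≐) → gs , gs≡ , ≐-trans (≐-sym C≐D) C≐)
        (λ n → proj₁ (chain n) , FinPols⊆𝓕 (proj₂ (chain n)))
        chain-injective

-- Cardinality of the two families

corollary23 : (∀ {ℓ : Level} → ExcludedMiddle ℓ) →
    ∀ {a : Level} (A : Set a) (Γ : Pred (Pred A a) (lsuc a)) →
    Finite (≐-setoid A a) Γ →
    (∃ λ γ → γ ∈ Γ × Satisfiable γ × γ ⊂ U) →
    Bijection (familySetoid (FinPols Γ)) (familySetoid (Pols Γ)) ×
    Bijection (familySetoid (Pols Γ)) (setoid ℕ)
corollary23 em A Γ fin (γ , γ∈Γ , (x , x∈γ) , _ , U⊈γ) =
  Composition.bijection FinPols≅ℕ (Symmetry.bijection-≡ Pols≅ℕ) , Pols≅ℕ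
  where
  outside : ∃ λ y → y ∉ γ
  -- Properness provides only the negation of `U ⊆ γ`; a point outside `γ` is extracted from it
  -- classically.
  outside = dne em λ none → U⊈γ λ {y} _ → dne em λ y∉γ → none (y , y∉γ)

  y∉γ = proj₂ outside

  FinPols≅ℕ = between-denumerable em Γ fin γ∈Γ x∈γ y∉γ id FinPols⊆Pols
  Pols≅ℕ    = between-denumerable em Γ fin γ∈Γ x∈γ y∉γ FinPols⊆Pols id
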